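{- Let $G=(V,E)$ be a $k$-regular graph on the vertices $v_1,v_2,\dotsc,v_{2n}$, fix a proper edge coloring (reference coloring) $c_0\colon E\to\{1,\dotsc,k\}$, and let $\operatorname{sgn}$ be defined relative to $c_0$ as in the context. Let $F=\{F_1,F_2,\dotsc,F_k\}$ be a 1-factorization of $G$. Then $$\operatorname{sgn}(F)=\prod_{i=1}^k\operatorname{sgn}(F_i).$$ Equivalently, for every proper edge coloring $c\colon E\to\{1,\dotsc,k\}$ we have $\operatorname{sgn}(c)=(-1)^{\operatorname{int}(c)}$, where $\operatorname{int}(c)$ is the number of intersections between edges of equal color when the vertices $v_1,\dotsc,v_{2n}$ are arranged consecutively on a circle and edges are drawn as straight line segments.
   Context: A 1-factor is a perfect matching; a 1-factorization of a $k$-regular graph is a partition of $E$ into $k$ 1-factors. For a 1-factor $F_1=\{e_1,\dotsc,e_n\}$ with $e_m=v_{i_m}v_{j_m}$, $i_m<j_m$, say $e_m$ intersects $e_p$ if $i_m<i_p<j_m<j_p$ or $i_p<i_m<j_p<j_m$; let $\operatorname{int}(F_1)$ be the number of unordered intersecting pairs of edges in $F_1$ and $\operatorname{sgn}(F_1):=(-1)^{\operatorname{int}(F_1)}$. For a proper edge coloring $c\colon E\to\{1,\dotsc,k\}$, $\operatorname{int}(c):=\sum_{\alpha=1}^k\operatorname{int}(c^{ -1}(\{\alpha\}))$ (each color class is a 1-factor). For proper edge colorings $c,c_0$ and a vertex $v$ with incident edge set $E(v)$, both $c|_{E(v)}$ and $c_0|_{E(v)}$ are bijections $E(v)\to\{1,\dotsc,k\}$;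 set $\operatorname{sgn}_v(c,c_0):=\operatorname{sgn}\big((c_0|_{E(v)})^{ -1}\circ c|_{E(v)}\big)$ (sign of a permutation of $E(v)$) and $\operatorname{sgn}(c,c_0):=\prod_{v\in V}\operatorname{sgn}_v(c,c_0)$. Define $\operatorname{sgn}(c_0):=(-1)^{\operatorname{int}(c_0)}$ and $\operatorname{sgn}(c):=\operatorname{sgn}(c,c_0)\operatorname{sgn}(c_0)$. For a 1-factorization $F$, $\operatorname{sgn}(F):=\operatorname{sgn}(c)$ for any proper edge coloring $c$ whose color classes are exactly the members of $F$ (this does not depend on the choice of $c$). -}

module Defs where

open import Data.Nat using (ℕ; zero; suc; _+_; _*_)
open import Data.Fin using (Fin; _<_; _<?_)
open import Data.Fin.Properties using (_≟_)
open import Data.Product using (_×_; _,_; proj₁; proj₂)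
open import Data.Bool using (Bool; true; false; _∧_; _∨_; if_then_else_)
open import Relation.Nullary.Decidable using (⌊_⌋)
open import Relation.Binary.PropositionalEquality using (_≡_)
open import Data.Sign using (Sign; opposite) renaming (_*_ to _·_)

-- Finite sums / counts / sign-products over Fin m.
sumFin : ∀ {m} → (Fin m → ℕ) → ℕ
sumFin {zero}  f = 0
sumFin {suc m} f = f Fin.zero + sumFin (λ i → f (Fin.suc i))
  where import Data.Fin as Fin

count : ∀ {m} → (Fin m → Bool) → ℕ
count p = sumFin (λ i → if p i then 1 else 0)

prodSign : ∀ {m} → (Fin m → Sign) → Sign
prodSign {zero}  f = Sign.+
prodSign {suc m} f = f Fin.zero · prodSign (λ i → f (Fin.suc i))
  where import Data.Fin as Fin

-- (-1)^n
parity : ℕ → Sign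
parity zero    = Sign.+
parity (suc n) = opposite (parity n)

-- A (finite simple) graph on the vertices v_1,...,v_N, represented as Fin N
-- (vertex v_{i+1} is the element i of Fin N, so the vertex order is the order of Fin N).
-- Edges are indexed by Fin m; edge e joins i_e = lo e and j_e = hi e with i_e < j_e.
record Graph (N : ℕ) : Set where
  field
    m      : ℕ
    ends   : Fin m → Fin N × Fin N
    ordered : ∀ e → proj₁ (ends e) < proj₂ (ends e)
    simple  : ∀ e e' → ends e ≡ ends e' → e ≡ e'

module _ {N : ℕ} (G : Graph N) where
  open Graph G

  lo hi : Fin m → Fin N
  lo e = proj₁ (ends e)
  hi e = proj₂ (ends e)

  -- e ∈ E(v)
  incident : Fin N → Fin m → Bool
  incident v e = ⌊ lo e ≟ v ⌋ ∨ ⌊ hi e ≟ v ⌋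

  degree : Fin N → ℕ
  degree v = count (incident v)

  Regular : ℕ → Set
  Regular k = ∀ v → degree v ≡ k

  -- proper edge coloring: edges sharing a vertex get different colors
  Proper : ∀ {k} → (Fin m → Fin k) → Set
  Proper c = ∀ v e e' → incident v e ≡ true → incident v e' ≡ true →
             c e ≡ c e' → e ≡ e'

  -- e_m intersects e_p : i_m < i_p < j_m < j_p  or  i_p < i_m < j_p < j_m
  intersects : Fin m → Fin m → Bool
  intersects e p =
    (⌊ lo e <? lo p ⌋ ∧ ⌊ lo p <? hi e ⌋ ∧ ⌊ hi e <? hi p ⌋) ∨
    (⌊ lo p <? lo e ⌋ ∧ ⌊ lo e <? hi p ⌋ ∧ ⌊ hi p <? hi e ⌋)

  -- int(S): number of unordered intersecting pairs of edges of the edge set S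
  intSet : (Fin m → Bool) → ℕ
  intSet S = sumFin (λ e → count (λ p →
    ⌊ e <? p ⌋ ∧ S e ∧ S p ∧ intersects e p))

  -- sgn(F₁) = (-1)^int(F₁) for a 1-factor F₁ (given as an edge set)
  sgnFactor : (Fin m → Bool) → Sign
  sgnFactor S = parity (intSet S)

  -- color class c⁻¹({α})
  colorClass : ∀ {k} → (Fin m → Fin k) → Fin k → Fin m → Bool
  colorClass c α e = ⌊ c e ≟ α ⌋

  -- int(c) = Σ_α int(c⁻¹({α}))
  intCol : ∀ {k} → (Fin m → Fin k) → ℕ
  intCol {k} c = sumFin {k} (λ α → intSet (colorClass c α))

  -- sgn_v(c,c₀) = sign of σ = (c₀|E(v))⁻¹ ∘ c|E(v), a permutation of E(v).
  -- Computed as (-1)^(number of inversions of σ w.r.t. the edge-index order):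
  -- pairs e < e' in E(v) with σ e > σ e', where σ e = f is the unique f ∈ E(v)
  -- with c₀ f = c e. We count quadruples (e,e',f,f') with f = σ e, f' = σ e'.
  inversions : ∀ {k} → (c c₀ : Fin m → Fin k) → Fin N → ℕ
  inversions c c₀ v =
    sumFin (λ e → sumFin (λ e' → sumFin (λ f → count (λ f' →
      incident v e ∧ incident v e' ∧ incident v f ∧ incident v f' ∧
      ⌊ e <? e' ⌋ ∧ ⌊ f' <? f ⌋ ∧
      ⌊ c₀ f ≟ c e ⌋ ∧ ⌊ c₀ f' ≟ c e' ⌋))))

  sgnAt : ∀ {k} → (c c₀ : Fin m → Fin k) → Fin N → Sign
  sgnAt c c₀ v = parity (inversions c c₀ v)

  -- sgn(c,c₀) = Π_v sgn_v(c,c₀)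
  sgnRel : ∀ {k} → (c c₀ : Fin m → Fin k) → Sign
  sgnRel c c₀ = prodSign (sgnAt c c₀)

  -- sgn(c) := sgn(c,c₀) · (-1)^int(c₀)   (relative to reference coloring c₀)
  sgnCol : ∀ {k} → (c₀ c : Fin m → Fin k) → Sign
  sgnCol c₀ c = sgnRel c c₀ · parity (intCol c₀)

-- Write ⟦ b ⟧ for (-1)^[b].  At a vertex v, a proper k-colouring of a k-regular graph uses every
-- colour exactly once, so sgn_v(c, c₀) is the parity of the pairs of colours whose edges are ordered
-- differently under c and under c₀.  Comparing both with the natural order of the colours gives
-- sgn_v(c, c₀) = σ_v(c) σ_v(c₀), where σ_v(c) counts the pairs of edges e < p at v with c p < c e.
-- Hence sgn(c, c₀) = σ(c) σ(c₀) with σ = ∏_v σ_v, and it suffices that (-1)^int(c) σ(c) does not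
-- depend on c.
--
-- For that, sum over pairs of half-edges: an end x of e and an end y of p, with e < p, α = c e,
-- β = c p.  Two edges of one colour are disjoint and cross iff an odd number of their four pairs of
-- ends have x < y, so int(c) ≡ Σ [α = β][x < y]; the terms with x = y and β < α add up to σ(c); and
--   [x<y][α=β] + [x=y][β<α] ≡ [x<y] + [β<α] + [x<y][α<β] + [y<x][β<α]   (mod 2).
-- Σ [β<α] is even since every edge has two ends, Σ [x<y] depends on G only, and the last two terms
-- together count the ordered pairs of half-edges on which position and colour agree.  Half-edges
-- correspond to pairs (vertex, colour), so that count is the same for every colouring.

module Submission where

open import Algebra.Bundles using (CommutativeMonoid)
open import Data.Bool using (Bool; true; false; _∧_; _∨_; if_then_else_)
import Data.Bool.Properties as Boolₚ
open import Data.Fin using (Fin; zero; suc; _<_; _<?_)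
open import Data.Fin.Properties using (_≟_; suc-injective; <-cmp; <-irrefl; <-trans; any?)
open import Data.Nat as ℕ using (ℕ; zero; suc; _+_; _*_; _≤_; z≤n; s≤s)
import Data.Nat.Properties as ℕₚ
open import Data.Product using (∃; _,_; proj₁; proj₂)
open import Data.Sign using (Sign; opposite) renaming (_*_ to _·_)
import Data.Sign.Properties as Signₚ
open import Data.Sum using (_⊎_; inj₁; inj₂)
open import Relation.Binary.Definitions using (tri<; tri≈; tri>)
open import Relation.Nullary using (¬_; Dec; yes; no; contradiction)
open import Function using (_∘_; id; case_of_)
open import Function.Definitions using (Injective)
open import Relation.Binary.PropositionalEquality as ≡ using (_≡_; _≢_; refl)
open import Relation.Nullary.Decidable using (⌊_⌋)

open import Defs

module _ {p} {P : Set p} where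

  ⌊⌋-true : (d : Dec P) → P → ⌊ d ⌋ ≡ true
  ⌊⌋-true (yes _) _  = refl
  ⌊⌋-true (no ¬p) p = contradiction p ¬p

  ⌊⌋-false : (d : Dec P) → ¬ P → ⌊ d ⌋ ≡ false
  ⌊⌋-false (yes p) ¬p = contradiction p ¬p
  ⌊⌋-false (no _)  _  = refl

  ⌊⌋-sound : (d : Dec P) → ⌊ d ⌋ ≡ true → P
  ⌊⌋-sound (yes p) _ = p

data Trichotomy : Bool → Bool → Bool → Set where
  less    : Trichotomy true  false false
  equal   : Trichotomy false true  false
  greater : Trichotomy false false true

module _ {n : ℕ} where

  _<ᵇ_ _≡ᵇ_ : Fin n → Fin n → Bool
  x <ᵇ y = ⌊ x <? y ⌋
  x ≡ᵇ y = ⌊ x ≟ y ⌋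

  trichotomy : (x y : Fin n) → Trichotomy (x <ᵇ y) (x ≡ᵇ y) (y <ᵇ x)
  trichotomy x y with <-cmp x y
  ... | tri< a ¬b ¬c rewrite ⌊⌋-true (x <? y) a | ⌊⌋-false (x ≟ y) ¬b | ⌊⌋-false (y <? x) ¬c = less
  ... | tri≈ ¬a b ¬c rewrite ⌊⌋-false (x <? y) ¬a | ⌊⌋-true (x ≟ y) b | ⌊⌋-false (y <? x) ¬c = equal
  ... | tri> ¬a ¬b c rewrite ⌊⌋-false (x <? y) ¬a | ⌊⌋-false (x ≟ y) ¬b | ⌊⌋-true (y <? x) c = greater

  ≡ᵇ-refl : (x : Fin n) → x ≡ᵇ x ≡ true
  ≡ᵇ-refl x = ⌊⌋-true (x ≟ x) refl

  ≡ᵇ-sound : {x y : Fin n} → x ≡ᵇ y ≡ true → x ≡ y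
  ≡ᵇ-sound {x} {y} = ⌊⌋-sound (x ≟ y)

  <ᵇ-irrefl : (x : Fin n) → x <ᵇ x ≡ false
  <ᵇ-irrefl x = ⌊⌋-false (x <? x) (<-irrefl refl)

  <ᵇ-sound : {x y : Fin n} → x <ᵇ y ≡ true → x < y
  <ᵇ-sound {x} {y} = ⌊⌋-sound (x <? y)

  <ᵇ-complete : {x y : Fin n} → x < y → x <ᵇ y ≡ true
  <ᵇ-complete {x} {y} = ⌊⌋-true (x <? y)

  <ᵇ-trans : {x y z : Fin n} → x <ᵇ y ≡ true → y <ᵇ z ≡ true → x <ᵇ z ≡ true
  <ᵇ-trans x<y y<z = <ᵇ-complete (<-trans (<ᵇ-sound x<y) (<ᵇ-sound y<z))

  trichotomy-≢ : {x y : Fin n} → x ≢ y → Trichotomy (x <ᵇ y) false (y <ᵇ x)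
  trichotomy-≢ {x} {y} x≢y = distinct (trichotomy x y) (⌊⌋-false (x ≟ y) x≢y)
    where
    distinct : ∀ {a b c} → Trichotomy a b c → b ≡ false → Trichotomy a false c
    distinct less    _ = less
    distinct greater _ = greater

module Indicator {a ℓ} (M : CommutativeMonoid a ℓ) where
  open CommutativeMonoid M
    renaming (refl to ≈-refl; sym to ≈-sym; trans to ≈-trans)
  open import Algebra.Properties.CommutativeMonoid.Sum M public
  open import Relation.Binary.Reasoning.Setoid setoid

  when : Bool → Carrier → Carrier
  when b x = if b then x else ε

  when-∧ : ∀ b c x → when (b ∧ c) x ≡ when b (when c x)
  when-∧ true  c x = refl
  when-∧ false c x = refl

  when-∙ : ∀ b x y → when b (x ∙ y) ≈ when b x ∙ when b y
  when-∙ true  x y = ≈-refl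
  when-∙ false x y = ≈-sym (identityˡ ε)

  when-∑ : ∀ {n} b (f : Fin n → Carrier) → when b (sum f) ≈ ∑[ i < n ] when b (f i)
  when-∑     true  f = ≈-refl
  when-∑ {n} false f = ≈-sym (sum-replicate-zero n)

  when-comm : ∀ a b x → when a (when b x) ≡ when b (when a x)
  when-comm true  true  x = refl
  when-comm true  false x = refl
  when-comm false true  x = refl
  when-comm false false x = refl

  when-ε : ∀ b → when b ε ≈ ε
  when-ε true  = ≈-refl
  when-ε false = ≈-refl

  when-∨ : ∀ {x y} → (x ≡ true → y ≡ false) → ∀ z → when (x ∨ y) z ≈ when x z ∙ when y z
  when-∨ {true}  disjoint z rewrite disjoint refl = ≈-sym (identityʳ z)
  when-∨ {false} disjoint z = ≈-sym (identityˡ _)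

  ∑-when-unique : ∀ {n} (P : Fin n → Bool) (f : Fin n → Carrier) (w : Fin n) →
                  P w ≡ true → (∀ i → P i ≡ true → i ≡ w) →
                  ∑[ i < n ] when (P i) (f i) ≈ f w
  ∑-when-unique {suc n} P f zero Pw unique rewrite Pw = begin
    f zero ∙ ∑[ i < n ] when (P (suc i)) (f (suc i)) ≈⟨ ∙-congˡ (sum-cong-≋ outside) ⟩
    f zero ∙ ∑[ i < n ] ε                          ≈⟨ ∙-congˡ (sum-replicate-zero n) ⟩
    f zero ∙ ε                                     ≈⟨ identityʳ (f zero) ⟩
    f zero                                          ∎
    where
    outside : ∀ i → when (P (suc i)) (f (suc i)) ≈ ε
    outside i with P (suc i) in eq
    ... | true  = case unique (suc i) eq of λ ()
    ... | false = ≈-refl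
  ∑-when-unique {suc n} P f (suc w) Pw unique with P zero in eq
  ... | true  = case unique zero eq of λ ()
  ... | false = ≈-trans (identityˡ _)
    (∑-when-unique (P ∘ suc) (f ∘ suc) w Pw (λ i Pi → suc-injective (unique (suc i) Pi)))

  when-partition : ∀ {k} b (w : Fin k) x → when b x ≈ ∑[ α < k ] when (b ∧ w ≡ᵇ α) x
  when-partition     true  w x = ≈-sym (∑-when-unique (w ≡ᵇ_) (λ _ → x) w (≡ᵇ-refl w) λ _ p → ≡.sym (≡ᵇ-sound p))
  when-partition {k} false w x = ≈-sym (sum-replicate-zero k)

module SignProduct = Indicator Signₚ.*-commutativeMonoid
open SignProduct
  using (when; when-∧; when-comm; when-∨; when-partition)
  renaming (sum to ∏; sum-cong-≗ to ∏-cong; ∑-comm to ∏-comm; ∑-distrib-+ to ∏-distrib-·;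
            sum-replicate-zero to ∏-+; when-∙ to when-·; when-∑ to when-∏; when-ε to when-+;
            ∑-when-unique to ∏-when-unique)

∏-syntax : ∀ n → (Fin n → Sign) → Sign
∏-syntax _ = ∏

syntax ∏-syntax n (λ i → x) = ∏[ i < n ] x

⟦_⟧ : Bool → Sign
⟦ b ⟧ = when b Sign.-

prodSign≡∏ : ∀ {n} (f : Fin n → Sign) → prodSign f ≡ ∏ f
prodSign≡∏ {zero}  f = refl
prodSign≡∏ {suc n} f = ≡.cong (f zero ·_) (prodSign≡∏ (f ∘ suc))

parity-+ : ∀ a b → parity (a + b) ≡ parity a · parity b
parity-+ zero    b = refl
parity-+ (suc a) b = ≡.trans (≡.cong opposite (parity-+ a b)) (≡.sym (Signₚ.*-assoc Sign.- (parity a) (parity b)))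

parity-sumFin : ∀ {n} (f : Fin n → ℕ) → parity (sumFin f) ≡ ∏[ i < n ] parity (f i)
parity-sumFin {zero}  f = refl
parity-sumFin {suc n} f = ≡.trans (parity-+ (f zero) _) (≡.cong (parity (f zero) ·_) (parity-sumFin (f ∘ suc)))

parity-count : ∀ {n} (p : Fin n → Bool) → parity (count p) ≡ ∏[ i < n ] ⟦ p i ⟧
parity-count {n} p = ≡.trans (parity-sumFin {n} _) (∏-cong λ i → parity-indicator (p i))
  where
  parity-indicator : ∀ b → parity (if b then 1 else 0) ≡ ⟦ b ⟧
  parity-indicator true  = refl
  parity-indicator false = refl

⟦∧⟧ : ∀ a b → ⟦ a ∧ b ⟧ ≡ when a ⟦ b ⟧
⟦∧⟧ a b = when-∧ a b Sign.-

∏-when : ∀ {n} b (f : Fin n → Sign) → ∏[ i < n ] when b (f i) ≡ when b (∏[ i < n ] f i)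
∏-when b f = ≡.sym (when-∏ b f)

∏²-when : ∀ {n n'} b (f : Fin n → Fin n' → Sign) →
          ∏[ i < n ] ∏[ j < n' ] when b (f i j) ≡ when b (∏[ i < n ] ∏[ j < n' ] f i j)
∏²-when {n} b f = ≡.trans (∏-cong {n} λ i → ∏-when b (f i)) (∏-when {n} b _)

∏³-when : ∀ {n n' n''} b (f : Fin n → Fin n' → Fin n'' → Sign) →
          ∏[ i < n ] ∏[ j < n' ] ∏[ l < n'' ] when b (f i j l) ≡
          when b (∏[ i < n ] ∏[ j < n' ] ∏[ l < n'' ] f i j l)
∏³-when {n} b f = ≡.trans (∏-cong {n} λ i → ∏²-when b (f i)) (∏-when {n} b _)

⟦∧⟧-gate₃ : ∀ a b g c → ⟦ a ∧ b ∧ g ∧ c ⟧ ≡ when g ⟦ a ∧ b ∧ c ⟧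
⟦∧⟧-gate₃ true  true  true  c = refl
⟦∧⟧-gate₃ true  true  false c = refl
⟦∧⟧-gate₃ true  false true  c = refl
⟦∧⟧-gate₃ true  false false c = refl
⟦∧⟧-gate₃ false b     true  c = refl
⟦∧⟧-gate₃ false b     false c = refl

⟦∧⟧-gate₃₄ : ∀ x y p q → ⟦ x ∧ y ∧ p ∧ q ⟧ ≡ when p (when q ⟦ x ∧ y ⟧)
⟦∧⟧-gate₃₄ true  true  true  true  = refl
⟦∧⟧-gate₃₄ true  true  true  false = refl
⟦∧⟧-gate₃₄ true  true  false _     = refl
⟦∧⟧-gate₃₄ true  false true  true  = refl
⟦∧⟧-gate₃₄ true  false true  false = refl
⟦∧⟧-gate₃₄ true  false false _     = refl
⟦∧⟧-gate₃₄ false _     true  true  = refl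
⟦∧⟧-gate₃₄ false _     true  false = refl
⟦∧⟧-gate₃₄ false _     false _     = refl

·-isolate : ∀ {i s a y} → (i · s) · (a · Sign.+) ≡ y → i ≡ s · (a · y)
·-isolate {Sign.+} {Sign.+} {Sign.+} refl = refl
·-isolate {Sign.+} {Sign.+} {Sign.-} refl = refl
·-isolate {Sign.+} {Sign.-} {Sign.+} refl = refl
·-isolate {Sign.+} {Sign.-} {Sign.-} refl = refl
·-isolate {Sign.-} {Sign.+} {Sign.+} refl = refl
·-isolate {Sign.-} {Sign.+} {Sign.-} refl = refl
·-isolate {Sign.-} {Sign.-} {Sign.+} refl = refl
·-isolate {Sign.-} {Sign.-} {Sign.-} refl = refl

·-cancel-middle : ∀ s t x → (s · t) · (t · x) ≡ s · x
·-cancel-middle s t x = ≡.trans (Signₚ.*-assoc s t (t · x))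
  (≡.cong (s ·_) (≡.trans (≡.sym (Signₚ.*-assoc t t x)) (≡.cong (_· x) (Signₚ.s*s≡+ t))))

∏²-symmetrise : ∀ {n} (F : Fin n → Fin n → Sign) → (∀ i → F i i ≡ Sign.+) →
                ∏[ i < n ] ∏[ j < n ] F i j ≡ ∏[ i < n ] ∏[ j < n ] when (i <ᵇ j) (F i j · F j i)
∏²-symmetrise {n} F diagonal = begin
  ∏[ i < n ] ∏[ j < n ] F i j
    ≡⟨ ∏-cong {n} (λ i → ∏-cong {n} (λ j → split (trichotomy i j) (F i j))) ⟩
  ∏[ i < n ] ∏[ j < n ] (when (i ≡ᵇ j) (F i j) · (when (i <ᵇ j) (F i j) · when (j <ᵇ i) (F i j)))
    ≡⟨ ∏-cong {n} (λ i → ∏-distrib-· {n} _ _) ⟩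
  ∏[ i < n ] (∏[ j < n ] when (i ≡ᵇ j) (F i j) · ∏[ j < n ] (when (i <ᵇ j) (F i j) · when (j <ᵇ i) (F i j)))
    ≡⟨ ∏-cong {n} (λ i → ≡.cong₂ _·_ (≡.trans (∏-when-unique (i ≡ᵇ_) (F i) i (≡ᵇ-refl i) λ _ p → ≡.sym (≡ᵇ-sound p))
                                              (diagonal i))
                                    refl) ⟩
  ∏[ i < n ] ∏[ j < n ] (when (i <ᵇ j) (F i j) · when (j <ᵇ i) (F i j))
    ≡⟨ ∏-cong {n} (λ i → ∏-distrib-· {n} _ _) ⟩
  ∏[ i < n ] (∏[ j < n ] when (i <ᵇ j) (F i j) · ∏[ j < n ] when (j <ᵇ i) (F i j))
    ≡⟨ ∏-distrib-· {n} _ _ ⟩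
  upper · ∏[ i < n ] ∏[ j < n ] when (j <ᵇ i) (F i j)
    ≡⟨ ≡.cong (upper ·_) (∏-comm {n} {n} _) ⟩
  upper · ∏[ i < n ] ∏[ j < n ] when (i <ᵇ j) (F j i)
    ≡⟨ ∏-distrib-· {n} _ _ ⟨
  ∏[ i < n ] (∏[ j < n ] when (i <ᵇ j) (F i j) · ∏[ j < n ] when (i <ᵇ j) (F j i))
    ≡⟨ ∏-cong {n} (λ i → ≡.trans (∏-cong {n} λ j → when-· (i <ᵇ j) _ _) (∏-distrib-· {n} _ _)) ⟨
  ∏[ i < n ] ∏[ j < n ] when (i <ᵇ j) (F i j · F j i)
    ∎
  where
  open ≡.≡-Reasoning
  upper : Sign
  upper = ∏[ i < n ] ∏[ j < n ] when (i <ᵇ j) (F i j)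
  split : ∀ {a b c} → Trichotomy a b c → ∀ x → x ≡ when b x · (when a x · when c x)
  split less    x = ≡.sym (Signₚ.*-identityʳ x)
  split equal   x = ≡.sym (Signₚ.*-identityʳ x)
  split greater x = refl

discord : ∀ {k a b} → (Fin k → Fin a) → (Fin k → Fin b) → Sign
discord {k} h g = ∏[ α < k ] ∏[ β < k ] ⟦ h α <ᵇ h β ∧ g β <ᵇ g α ⟧

discord-pair : ∀ {l e l' x x' y y'} → Trichotomy l e l' →
               (l ≡ true → Trichotomy x false x') → (l ≡ true → Trichotomy y false y') →
               when l (⟦ x ∧ y' ⟧ · ⟦ x' ∧ y ⟧) ≡
               when l (⟦ x ∧ l' ⟧ · ⟦ x' ∧ l ⟧) · when l (⟦ y ∧ l' ⟧ · ⟦ y' ∧ l ⟧)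
discord-pair equal   _ _ = refl
discord-pair greater _ _ = refl
discord-pair less    hx hy with hx refl | hy refl
... | less    | less    = refl
... | less    | greater = refl
... | greater | less    = refl
... | greater | greater = refl

discord-through-id : ∀ {k a b} {h : Fin k → Fin a} {g : Fin k → Fin b} →
                     Injective _≡_ _≡_ h → Injective _≡_ _≡_ g → discord h g ≡ discord h id · discord g id
discord-through-id {k} {h = h} {g} h-inj g-inj = begin
  discord h g
    ≡⟨ ∏²-symmetrise _ (irreflexive h λ α β → g β <ᵇ g α) ⟩
  ∏[ α < k ] ∏[ β < k ] when (α <ᵇ β) (⟦ h α <ᵇ h β ∧ g β <ᵇ g α ⟧ · ⟦ h β <ᵇ h α ∧ g α <ᵇ g β ⟧)
    ≡⟨ ∏-cong {k} (λ α → ∏-cong {k} λ β →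
         discord-pair (trichotomy α β) (apart h-inj) (apart g-inj)) ⟩
  ∏[ α < k ] ∏[ β < k ] (when (α <ᵇ β) (⟦ h α <ᵇ h β ∧ β <ᵇ α ⟧ · ⟦ h β <ᵇ h α ∧ α <ᵇ β ⟧) ·
                         when (α <ᵇ β) (⟦ g α <ᵇ g β ∧ β <ᵇ α ⟧ · ⟦ g β <ᵇ g α ∧ α <ᵇ β ⟧))
    ≡⟨ ≡.trans (∏-cong {k} λ α → ∏-distrib-· {k} _ _) (∏-distrib-· {k} _ _) ⟩
  ∏[ α < k ] ∏[ β < k ] when (α <ᵇ β) (⟦ h α <ᵇ h β ∧ β <ᵇ α ⟧ · ⟦ h β <ᵇ h α ∧ α <ᵇ β ⟧) ·
  ∏[ α < k ] ∏[ β < k ] when (α <ᵇ β) (⟦ g α <ᵇ g β ∧ β <ᵇ α ⟧ · ⟦ g β <ᵇ g α ∧ α <ᵇ β ⟧)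
    ≡⟨ ≡.cong₂ _·_ (∏²-symmetrise _ (irreflexive h λ α β → β <ᵇ α))
                   (∏²-symmetrise _ (irreflexive g λ α β → β <ᵇ α)) ⟨
  discord h id · discord g id
    ∎
  where
  open ≡.≡-Reasoning
  irreflexive : ∀ {c} (f : Fin k → Fin c) (r : Fin k → Fin k → Bool) α → ⟦ f α <ᵇ f α ∧ r α α ⟧ ≡ Sign.+
  irreflexive f r α = ≡.cong (λ t → ⟦ t ∧ r α α ⟧) (<ᵇ-irrefl (f α))
  apart : ∀ {c} {f : Fin k → Fin c} → Injective _≡_ _≡_ f → ∀ {α β} → α <ᵇ β ≡ true →
          Trichotomy (f α <ᵇ f β) false (f β <ᵇ f α)
  apart f-inj α<β = trichotomy-≢ λ fα≡fβ → <-irrefl (f-inj fα≡fβ) (<ᵇ-sound α<β)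

-- Chords ab and cd (a < b, c < d, no common end) cross iff an odd number of the pairs
-- (x, y) ∈ {a, b} × {c, d} have x < y; the right-hand side is ∏[ s < 2 ] ∏[ s' < 2 ] in normal form.
crossing-sign : ∀ {ac ca ad da bc cb bd db} →
                Trichotomy ac false ca → Trichotomy ad false da → Trichotomy bc false cb → Trichotomy bd false db →
                (ac ≡ true → ad ≡ true) → (bc ≡ true → bd ≡ true) →
                (bc ≡ true → ac ≡ true) → (bd ≡ true → ad ≡ true) →
                ⟦ (ac ∧ cb ∧ bd) ∨ (ca ∧ ad ∧ db) ⟧ ≡
                (⟦ ac ⟧ · (⟦ ad ⟧ · Sign.+)) · ((⟦ bc ⟧ · (⟦ bd ⟧ · Sign.+)) · Sign.+)
crossing-sign less    less    less    less    _  _  _  _  = refl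
crossing-sign less    less    greater less    _  _  _  _  = refl
crossing-sign less    less    greater greater _  _  _  _  = refl
crossing-sign greater less    greater less    _  _  _  _  = refl
crossing-sign greater less    greater greater _  _  _  _  = refl
crossing-sign greater greater greater greater _  _  _  _  = refl
crossing-sign less    greater _       _       h₁ _  _  _  = case h₁ refl of λ ()
crossing-sign _       _       less    greater _  h₂ _  _  = case h₂ refl of λ ()
crossing-sign greater _       less    _       _  _  h₃ _  = case h₃ refl of λ ()
crossing-sign _       greater _       less    _  _  _  h₄ = case h₄ refl of λ ()

-- [x<y][α=β] + [x=y][β<α] + [x<y] + [β<α] ≡ [x<y][α<β] + [y<x][β<α] (mod 2), where a, a₀, a' is
-- the trichotomy of x, y and γ, η, γ' that of α, β.
two-orders-sign : ∀ {a a₀ a' γ η γ'} → Trichotomy a a₀ a' → Trichotomy γ η γ' →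
                  (⟦ η ∧ a ⟧ · ⟦ a₀ ∧ γ' ⟧) · (⟦ a ⟧ · ⟦ γ' ⟧) ≡ ⟦ a ∧ γ ⟧ · ⟦ a' ∧ γ' ⟧
two-orders-sign less    less    = refl
two-orders-sign less    equal   = refl
two-orders-sign less    greater = refl
two-orders-sign equal   less    = refl
two-orders-sign equal   equal   = refl
two-orders-sign equal   greater = refl
two-orders-sign greater less    = refl
two-orders-sign greater equal   = refl
two-orders-sign greater greater = refl

orderSign : ℕ → ℕ → Sign
orderSign N k = ∏[ v < N ] ∏[ α < k ] ∏[ v' < N ] ∏[ β < k ] ⟦ v <ᵇ v' ∧ α <ᵇ β ⟧

module NatSum = Indicator ℕₚ.+-0-commutativeMonoid
open NatSum using (sum-syntax)

sumFin≡∑ : ∀ {n} (f : Fin n → ℕ) → sumFin f ≡ NatSum.sum f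
sumFin≡∑ {zero}  f = refl
sumFin≡∑ {suc n} f = ≡.cong (f zero +_) (sumFin≡∑ (f ∘ suc))

∑≤n : ∀ {n} (f : Fin n → ℕ) → (∀ i → f i ≤ 1) → NatSum.sum f ≤ n
∑≤n {zero}  f bounded = z≤n
∑≤n {suc n} f bounded = ℕₚ.+-mono-≤ (bounded zero) (∑≤n (f ∘ suc) (bounded ∘ suc))

∑<n : ∀ {n} (f : Fin n → ℕ) → (∀ i → f i ≤ 1) → ∀ j → f j ≡ 0 → NatSum.sum f ℕ.< n
∑<n {suc n} f bounded zero    fj≡0 rewrite fj≡0 = s≤s (∑≤n (f ∘ suc) (bounded ∘ suc))
∑<n {suc n} f bounded (suc j) fj≡0 =
  ℕₚ.+-mono-≤-< (bounded zero) (∑<n (f ∘ suc) (bounded ∘ suc) j fj≡0)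

module _ {N : ℕ} (G : Graph N) where
  open Graph G

  end : Fin m → Fin 2 → Fin N
  end e zero    = lo G e
  end e (suc _) = hi G e

  incident-end : ∀ e s → incident G (end e s) e ≡ true
  incident-end e zero    rewrite ≡ᵇ-refl (lo G e) = refl
  incident-end e (suc _) rewrite ≡ᵇ-refl (hi G e) with lo G e ≡ᵇ hi G e
  ... | true  = refl
  ... | false = refl

  ∏-ends : ∀ e (H : Fin N → Sign) → ∏[ s < 2 ] H (end e s) ≡ ∏[ v < N ] when (incident G v e) (H v)
  ∏-ends e H = ≡.sym (begin
    ∏[ v < N ] when (incident G v e) (H v)                            ≡⟨ ∏-cong (λ v → when-∨ (ends-distinct v) (H v)) ⟩
    ∏[ v < N ] (when (lo G e ≡ᵇ v) (H v) · when (hi G e ≡ᵇ v) (H v))  ≡⟨ ∏-distrib-· {N} _ _ ⟩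
    ∏[ v < N ] when (lo G e ≡ᵇ v) (H v) · ∏[ v < N ] when (hi G e ≡ᵇ v) (H v)
      ≡⟨ ≡.cong₂ _·_ (at (lo G e)) (≡.trans (at (hi G e)) (≡.sym (Signₚ.*-identityʳ _))) ⟩
    ∏[ s < 2 ] H (end e s)                                            ∎)
    where
    open ≡.≡-Reasoning
    ends-distinct : ∀ v → lo G e ≡ᵇ v ≡ true → hi G e ≡ᵇ v ≡ false
    ends-distinct v lo≡v = ⌊⌋-false (hi G e ≟ v) λ hi≡v →
      <-irrefl (≡.trans (≡ᵇ-sound lo≡v) (≡.sym hi≡v)) (ordered e)
    at : ∀ u → ∏[ v < N ] when (u ≡ᵇ v) (H v) ≡ H u
    at u = ∏-when-unique (u ≡ᵇ_) H u (≡ᵇ-refl u) (λ _ p → ≡.sym (≡ᵇ-sound p))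

  vertexSign : ∀ {k} → (Fin m → Fin k) → Fin N → Sign
  vertexSign c v = ∏[ e < m ] when (incident G v e) (∏[ p < m ] when (incident G v p) ⟦ e <ᵇ p ∧ c p <ᵇ c e ⟧)

  intersects-sign : ∀ e p → (∀ s s' → end e s ≢ end p s') →
                    ⟦ intersects G e p ⟧ ≡ ∏[ s < 2 ] ∏[ s' < 2 ] ⟦ end e s <ᵇ end p s' ⟧
  intersects-sign e p apart =
    crossing-sign (trichotomy-≢ (apart zero zero)) (trichotomy-≢ (apart zero (suc zero)))
                  (trichotomy-≢ (apart (suc zero) zero)) (trichotomy-≢ (apart (suc zero) (suc zero)))
                  (λ ac → <ᵇ-trans ac p-ordered) (λ bc → <ᵇ-trans bc p-ordered)
                  (<ᵇ-trans e-ordered) (<ᵇ-trans e-ordered)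
    where
    e-ordered = <ᵇ-complete (ordered e)
    p-ordered = <ᵇ-complete (ordered p)

  -- Product over the pairs of half-edges (e, s), (p, s') with e < p.
  ∏ₚ : (Fin m → Fin m → Fin 2 → Fin 2 → Sign) → Sign
  ∏ₚ F = ∏[ e < m ] ∏[ p < m ] when (e <ᵇ p) (∏[ s < 2 ] ∏[ s' < 2 ] F e p s s')

  ∏ₚ-cong : ∀ {F H} → (∀ e p s s' → F e p s s' ≡ H e p s s') → ∏ₚ F ≡ ∏ₚ H
  ∏ₚ-cong eq = ∏-cong {m} λ e → ∏-cong {m} λ p →
    ≡.cong (when (e <ᵇ p)) (∏-cong {2} λ s → ∏-cong {2} λ s' → eq e p s s')

  ∏ₚ-· : ∀ F H → ∏ₚ (λ e p s s' → F e p s s' · H e p s s') ≡ ∏ₚ F · ∏ₚ H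
  ∏ₚ-· F H = ≡.trans (∏-cong {m} λ e → ≡.trans (∏-cong {m} λ p → pair e p) (∏-distrib-· {m} _ _))
                     (∏-distrib-· {m} _ _)
    where
    pair : ∀ e p → when (e <ᵇ p) (∏[ s < 2 ] ∏[ s' < 2 ] (F e p s s' · H e p s s'))
                 ≡ when (e <ᵇ p) (∏[ s < 2 ] ∏[ s' < 2 ] F e p s s') · when (e <ᵇ p) (∏[ s < 2 ] ∏[ s' < 2 ] H e p s s')
    pair e p = ≡.trans (≡.cong (when (e <ᵇ p)) (≡.trans
                 (∏-cong {2} λ s → ∏-distrib-· (F e p s) (H e p s))
                 (∏-distrib-· (λ s → ∏[ s' < 2 ] F e p s s') (λ s → ∏[ s' < 2 ] H e p s s'))))
               (when-· (e <ᵇ p) _ _)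

  ∏ₚ-const : ∀ (x : Fin m → Fin m → Sign) → ∏ₚ (λ e p _ _ → x e p) ≡ Sign.+
  ∏ₚ-const x = ≡.trans (∏-cong {m} λ e → ≡.trans (∏-cong {m} λ p →
                 ≡.trans (≡.cong (when (e <ᵇ p)) (fourth-power (x e p))) (when-+ (e <ᵇ p))) (∏-+ m)) (∏-+ m)
    where
    fourth-power : ∀ y → ∏[ s < 2 ] ∏[ s' < 2 ] y ≡ Sign.+
    fourth-power Sign.+ = refl
    fourth-power Sign.- = refl

  common-ends : ∀ e p K → ∏[ s < 2 ] ∏[ s' < 2 ] ⟦ end e s ≡ᵇ end p s' ∧ K ⟧ ≡
                          ∏[ v < N ] when (incident G v e) (when (incident G v p) ⟦ K ⟧)
  common-ends e p K = begin
    ∏[ s < 2 ] ∏[ s' < 2 ] ⟦ end e s ≡ᵇ end p s' ∧ K ⟧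
      ≡⟨ ∏-cong {2} (λ s → ∏-ends p (λ u → ⟦ end e s ≡ᵇ u ∧ K ⟧)) ⟩
    ∏[ s < 2 ] ∏[ u < N ] when (incident G u p) ⟦ end e s ≡ᵇ u ∧ K ⟧
      ≡⟨ ∏-comm (λ s u → when (incident G u p) ⟦ end e s ≡ᵇ u ∧ K ⟧) ⟩
    ∏[ u < N ] ∏[ s < 2 ] when (incident G u p) ⟦ end e s ≡ᵇ u ∧ K ⟧
      ≡⟨ ∏-cong {N} (λ u → ≡.trans (∏-when (incident G u p) (λ s → ⟦ end e s ≡ᵇ u ∧ K ⟧))
                                     (≡.cong (when (incident G u p)) (meeting u))) ⟩
    ∏[ u < N ] when (incident G u p) (when (incident G u e) ⟦ K ⟧)
      ≡⟨ ∏-cong {N} (λ u → when-comm (incident G u p) (incident G u e) ⟦ K ⟧) ⟩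
    ∏[ u < N ] when (incident G u e) (when (incident G u p) ⟦ K ⟧)
      ∎
    where
    open ≡.≡-Reasoning
    meeting : ∀ u → ∏[ s < 2 ] ⟦ end e s ≡ᵇ u ∧ K ⟧ ≡ when (incident G u e) ⟦ K ⟧
    meeting u = ≡.trans (∏-ends e (λ w → ⟦ w ≡ᵇ u ∧ K ⟧)) (≡.trans
      (∏-cong {N} λ w → ≡.trans (≡.cong (when (incident G w e)) (⟦∧⟧ (w ≡ᵇ u) K))
                                (when-comm (incident G w e) (w ≡ᵇ u) ⟦ K ⟧))
      (∏-when-unique (_≡ᵇ u) (λ w → when (incident G w e) ⟦ K ⟧) u (≡ᵇ-refl u) (λ _ q → ≡ᵇ-sound q)))

  ∏ₚ-common-ends : ∀ {k} (c : Fin m → Fin k) →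
                   ∏ₚ (λ e p s s' → ⟦ end e s ≡ᵇ end p s' ∧ c p <ᵇ c e ⟧) ≡ ∏[ v < N ] vertexSign c v
  ∏ₚ-common-ends c = begin
    ∏ₚ (λ e p s s' → ⟦ end e s ≡ᵇ end p s' ∧ c p <ᵇ c e ⟧)
      ≡⟨ ∏-cong {m} (λ e → ∏-cong {m} λ p →
           ≡.trans (≡.cong (when (e <ᵇ p)) (common-ends e p _)) (when-∏ {N} (e <ᵇ p) _)) ⟩
    ∏[ e < m ] ∏[ p < m ] ∏[ v < N ] when (e <ᵇ p) (when (I v e) (when (I v p) ⟦ c p <ᵇ c e ⟧))
      ≡⟨ ∏-cong {m} (λ e → ∏-cong {m} λ p → ∏-cong {N} λ v → regate e p v) ⟩
    ∏[ e < m ] ∏[ p < m ] ∏[ v < N ] when (I v e) (when (I v p) ⟦ e <ᵇ p ∧ c p <ᵇ c e ⟧)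
      ≡⟨ ≡.trans (∏-cong {m} λ e → ∏-comm {m} {N} _) (∏-comm {m} {N} _) ⟩
    ∏[ v < N ] ∏[ e < m ] ∏[ p < m ] when (I v e) (when (I v p) ⟦ e <ᵇ p ∧ c p <ᵇ c e ⟧)
      ≡⟨ ∏-cong {N} (λ v → ∏-cong {m} λ e → ∏-when {m} (I v e) _) ⟩
    ∏[ v < N ] vertexSign c v
      ∎
    where
    open ≡.≡-Reasoning
    I : Fin N → Fin m → Bool
    I = incident G
    regate : ∀ e p v → when (e <ᵇ p) (when (I v e) (when (I v p) ⟦ c p <ᵇ c e ⟧)) ≡
                       when (I v e) (when (I v p) ⟦ e <ᵇ p ∧ c p <ᵇ c e ⟧)
    regate e p v = ≡.trans (when-comm (e <ᵇ p) (I v e) _) (≡.cong (when (I v e))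
                     (≡.trans (when-comm (e <ᵇ p) (I v p) _) (≡.cong (when (I v p)) (≡.sym (⟦∧⟧ (e <ᵇ p) _)))))

  ∏ₚ-symmetrise : ∀ (Φ : Fin m → Fin m → Fin 2 → Fin 2 → Sign) → (∀ e s s' → Φ e e s s' ≡ Sign.+) →
                  ∏ₚ (λ e p s s' → Φ e p s s' · Φ p e s' s) ≡ ∏[ e < m ] ∏[ p < m ] ∏[ s < 2 ] ∏[ s' < 2 ] Φ e p s s'
  ∏ₚ-symmetrise Φ diagonal = ≡.sym (≡.trans
    (∏²-symmetrise F (λ e → ∏-cong {2} λ s → ∏-cong {2} λ s' → diagonal e s s'))
    (∏-cong {m} λ e → ∏-cong {m} λ p → ≡.cong (when (e <ᵇ p)) (merge e p)))
    where
    F : Fin m → Fin m → Sign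
    F e p = ∏[ s < 2 ] ∏[ s' < 2 ] Φ e p s s'
    merge : ∀ e p → F e p · F p e ≡ ∏[ s < 2 ] ∏[ s' < 2 ] (Φ e p s s' · Φ p e s' s)
    merge e p = ≡.trans (≡.cong (F e p ·_) (∏-comm (Φ p e)))
      (≡.sym (≡.trans (∏-cong {2} λ s → ∏-distrib-· (Φ e p s) (λ s' → Φ p e s' s))
                      (∏-distrib-· (λ s → ∏[ s' < 2 ] Φ e p s s') (λ s → ∏[ s' < 2 ] Φ p e s' s))))

  colouringSign : ∀ {k} → (Fin m → Fin k) → Sign
  colouringSign c = ∏[ v < N ] vertexSign c v

  crossingConstant : ℕ → Sign
  crossingConstant k = ∏ₚ (λ e p s s' → ⟦ end e s <ᵇ end p s' ⟧) · orderSign N k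

  module Colouring {k : ℕ} (regular : Regular G k) (c : Fin m → Fin k) (proper : Proper G c) where

    hasColourAt : Fin N → Fin k → Fin m → Bool
    hasColourAt v α e = incident G v e ∧ c e ≡ᵇ α

    hasColourAt-unique : ∀ {v α e e'} → hasColourAt v α e ≡ true → hasColourAt v α e' ≡ true → e ≡ e'
    hasColourAt-unique {v} {α} {e} {e'} p q =
      proper v e e' (Boolₚ.∧-conicalˡ _ _ p) (Boolₚ.∧-conicalˡ _ _ q)
        (≡.trans (≡ᵇ-sound (Boolₚ.∧-conicalʳ _ _ p)) (≡.sym (≡ᵇ-sound (Boolₚ.∧-conicalʳ _ _ q))))

    colourDegree : Fin N → Fin k → ℕ
    colourDegree v α = ∑[ e < m ] NatSum.when (hasColourAt v α e) 1

    colourDegree-dichotomy : ∀ v α → (∃ λ e → hasColourAt v α e ≡ true) ⊎ colourDegree v α ≡ 0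
    colourDegree-dichotomy v α with any? (λ e → hasColourAt v α e Boolₚ.≟ true)
    ... | yes found = inj₁ found
    ... | no ∄e = inj₂ (≡.trans (NatSum.sum-cong-≗ absent) (NatSum.sum-replicate-zero m))
      where
      absent : ∀ e → NatSum.when (hasColourAt v α e) 1 ≡ 0
      absent e with hasColourAt v α e in p
      ... | true  = contradiction (e , p) ∄e
      ... | false = refl

    colourDegree≤1 : ∀ v α → colourDegree v α ≤ 1
    colourDegree≤1 v α with colourDegree-dichotomy v α
    ... | inj₁ (e , p) = ℕₚ.≤-reflexive (NatSum.∑-when-unique _ _ e p λ _ q → hasColourAt-unique q p)
    ... | inj₂ none    = ℕₚ.≤-trans (ℕₚ.≤-reflexive none) z≤n

    degree≡∑colourDegree : ∀ v → degree G v ≡ ∑[ α < k ] colourDegree v α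
    degree≡∑colourDegree v = begin
      degree G v
        ≡⟨ sumFin≡∑ {m} _ ⟩
      ∑[ e < m ] NatSum.when (incident G v e) 1
        ≡⟨ NatSum.sum-cong-≗ (λ e → NatSum.when-partition _ (c e) 1) ⟩
      ∑[ e < m ] ∑[ α < k ] NatSum.when (hasColourAt v α e) 1
        ≡⟨ NatSum.∑-comm {m} {k} _ ⟩
      ∑[ α < k ] colourDegree v α
        ∎
      where open ≡.≡-Reasoning

    edgeOfColour : ∀ v α → ∃ λ e → hasColourAt v α e ≡ true
    edgeOfColour v α with colourDegree-dichotomy v α
    ... | inj₁ found = found
    ... | inj₂ none  = contradiction (∑<n (colourDegree v) (colourDegree≤1 v) α none)
      (ℕₚ.<-irrefl (≡.trans (≡.sym (degree≡∑colourDegree v)) (regular v)))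

    edgeAt : Fin N → Fin k → Fin m
    edgeAt v α = proj₁ (edgeOfColour v α)

    edgeAt-colour : ∀ v α → c (edgeAt v α) ≡ α
    edgeAt-colour v α = ≡ᵇ-sound (Boolₚ.∧-conicalʳ _ _ (proj₂ (edgeOfColour v α)))

    ∏-incident : ∀ v (Ψ : Fin m → Sign) → ∏[ e < m ] when (incident G v e) (Ψ e) ≡ ∏[ α < k ] Ψ (edgeAt v α)
    ∏-incident v Ψ = begin
      ∏[ e < m ] when (incident G v e) (Ψ e)
        ≡⟨ ∏-cong (λ e → when-partition _ (c e) (Ψ e)) ⟩
      ∏[ e < m ] ∏[ α < k ] when (hasColourAt v α e) (Ψ e)
        ≡⟨ ∏-comm {m} {k} _ ⟩
      ∏[ α < k ] ∏[ e < m ] when (hasColourAt v α e) (Ψ e)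
        ≡⟨ ∏-cong (λ α → ∏-when-unique _ Ψ (edgeAt v α) (found α) (λ _ p → hasColourAt-unique p (found α))) ⟩
      ∏[ α < k ] Ψ (edgeAt v α)
        ∎
      where
      open ≡.≡-Reasoning
      found : ∀ α → hasColourAt v α (edgeAt v α) ≡ true
      found α = proj₂ (edgeOfColour v α)

    edgeAt-injective : ∀ v → Injective _≡_ _≡_ (edgeAt v)
    edgeAt-injective v {α} {β} eq = ≡.trans (≡.sym (edgeAt-colour v α)) (≡.trans (≡.cong c eq) (edgeAt-colour v β))

    vertexSign≡discord : ∀ v → vertexSign c v ≡ discord (edgeAt v) id
    vertexSign≡discord v = ≡.trans (∏-incident v _) (∏-cong {k} λ α → ≡.trans (∏-incident v _) (∏-cong {k} λ β →
      ≡.cong₂ (λ γ δ → ⟦ edgeAt v α <ᵇ edgeAt v β ∧ γ <ᵇ δ ⟧) (edgeAt-colour v β) (edgeAt-colour v α)))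

    ∏-halfEdges : ∀ (H : Fin N → Fin k → Sign) → ∏[ e < m ] ∏[ s < 2 ] H (end e s) (c e) ≡ ∏[ v < N ] ∏[ α < k ] H v α
    ∏-halfEdges H = begin
      ∏[ e < m ] ∏[ s < 2 ] H (end e s) (c e)
        ≡⟨ ∏-cong {m} (λ e → ∏-ends e (λ v → H v (c e))) ⟩
      ∏[ e < m ] ∏[ v < N ] when (incident G v e) (H v (c e))
        ≡⟨ ∏-comm {m} {N} _ ⟩
      ∏[ v < N ] ∏[ e < m ] when (incident G v e) (H v (c e))
        ≡⟨ ∏-cong {N} (λ v → ∏-incident v (λ e → H v (c e))) ⟩
      ∏[ v < N ] ∏[ α < k ] H v (c (edgeAt v α))
        ≡⟨ ∏-cong {N} (λ v → ∏-cong {k} λ α → ≡.cong (H v) (edgeAt-colour v α)) ⟩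
      ∏[ v < N ] ∏[ α < k ] H v α
        ∎
      where open ≡.≡-Reasoning

    ∏-ordered-halfEdge-pairs :
      ∏[ e < m ] ∏[ p < m ] ∏[ s < 2 ] ∏[ s' < 2 ] ⟦ end e s <ᵇ end p s' ∧ c e <ᵇ c p ⟧ ≡ orderSign N k
    ∏-ordered-halfEdge-pairs = begin
      ∏[ e < m ] ∏[ p < m ] ∏[ s < 2 ] ∏[ s' < 2 ] ⟦ end e s <ᵇ end p s' ∧ c e <ᵇ c p ⟧
        ≡⟨ ∏-cong {m} (λ e → ∏-comm (λ p s → ∏[ s' < 2 ] ⟦ end e s <ᵇ end p s' ∧ c e <ᵇ c p ⟧)) ⟩
      ∏[ e < m ] ∏[ s < 2 ] ∏[ p < m ] ∏[ s' < 2 ] ⟦ end e s <ᵇ end p s' ∧ c e <ᵇ c p ⟧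
        ≡⟨ ∏-cong {m} (λ e → ∏-cong {2} λ s → ∏-halfEdges (λ v' β → ⟦ end e s <ᵇ v' ∧ c e <ᵇ β ⟧)) ⟩
      ∏[ e < m ] ∏[ s < 2 ] ∏[ v' < N ] ∏[ β < k ] ⟦ end e s <ᵇ v' ∧ c e <ᵇ β ⟧
        ≡⟨ ∏-halfEdges (λ v α → ∏[ v' < N ] ∏[ β < k ] ⟦ v <ᵇ v' ∧ α <ᵇ β ⟧) ⟩
      orderSign N k
        ∎
      where open ≡.≡-Reasoning

    same-colour-apart : ∀ {e p} → e <ᵇ p ≡ true → c e ≡ᵇ c p ≡ true → ∀ s s' → end e s ≢ end p s'
    same-colour-apart {e} {p} e<p ce≡cp s s' meet =
      <-irrefl (proper (end e s) e p (incident-end e s) (≡.subst (λ v → incident G v p ≡ true) (≡.sym meet) (incident-end p s'))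
                       (≡ᵇ-sound ce≡cp))
               (<ᵇ-sound e<p)

    same-colour-crossing : ∀ e p → when (e <ᵇ p) ⟦ c e ≡ᵇ c p ∧ intersects G e p ⟧ ≡
                                   when (e <ᵇ p) (∏[ s < 2 ] ∏[ s' < 2 ] ⟦ c e ≡ᵇ c p ∧ end e s <ᵇ end p s' ⟧)
    same-colour-crossing e p with e <ᵇ p in e<p | c e ≡ᵇ c p in ce≡cp
    ... | false | _     = refl
    ... | true  | false = refl
    ... | true  | true  = intersects-sign e p (same-colour-apart e<p ce≡cp)

    parity-intCol-ends : parity (intCol G c) ≡ ∏ₚ (λ e p s s' → ⟦ c e ≡ᵇ c p ∧ end e s <ᵇ end p s' ⟧)
    parity-intCol-ends = begin
      parity (intCol G c)
        ≡⟨ ≡.trans (parity-sumFin {k} _) (∏-cong {k} λ α →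
             ≡.trans (parity-sumFin {m} _) (∏-cong {m} λ e → parity-count {m} _)) ⟩
      ∏[ α < k ] ∏[ e < m ] ∏[ p < m ] ⟦ e <ᵇ p ∧ c e ≡ᵇ α ∧ c p ≡ᵇ α ∧ intersects G e p ⟧
        ≡⟨ ≡.trans (∏-comm {k} {m} _) (∏-cong {m} λ e → ∏-comm {k} {m} _) ⟩
      ∏[ e < m ] ∏[ p < m ] ∏[ α < k ] ⟦ e <ᵇ p ∧ c e ≡ᵇ α ∧ c p ≡ᵇ α ∧ intersects G e p ⟧
        ≡⟨ ∏-cong {m} (λ e → ∏-cong {m} λ p → colour-classes e p) ⟩
      ∏[ e < m ] ∏[ p < m ] when (e <ᵇ p) ⟦ c e ≡ᵇ c p ∧ intersects G e p ⟧
        ≡⟨ ∏-cong {m} (λ e → ∏-cong {m} λ p → same-colour-crossing e p) ⟩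
      ∏ₚ (λ e p s s' → ⟦ c e ≡ᵇ c p ∧ end e s <ᵇ end p s' ⟧)
        ∎
      where
      open ≡.≡-Reasoning
      colour-classes : ∀ e p → ∏[ α < k ] ⟦ e <ᵇ p ∧ c e ≡ᵇ α ∧ c p ≡ᵇ α ∧ intersects G e p ⟧ ≡
                               when (e <ᵇ p) ⟦ c e ≡ᵇ c p ∧ intersects G e p ⟧
      colour-classes e p = ≡.trans
        (∏-cong {k} λ α → ⟦∧⟧-gate₃ (e <ᵇ p) (c e ≡ᵇ α) (c p ≡ᵇ α) (intersects G e p))
        (≡.trans (∏-when-unique (c p ≡ᵇ_) (λ α → ⟦ e <ᵇ p ∧ c e ≡ᵇ α ∧ intersects G e p ⟧)
                                (c p) (≡ᵇ-refl (c p)) (λ _ q → ≡.sym (≡ᵇ-sound q)))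
                 (⟦∧⟧ (e <ᵇ p) _))

    parity-intCol : parity (intCol G c) ≡ colouringSign c · crossingConstant k
    parity-intCol = ·-isolate {parity (intCol G c)} {colouringSign c} {∏ₚ endOrder} (begin
      (parity (intCol G c) · colouringSign c) · (∏ₚ endOrder · Sign.+)
        ≡⟨ ≡.cong₂ _·_ (≡.cong₂ _·_ parity-intCol-ends (≡.sym (∏ₚ-common-ends c)))
                       (≡.cong (∏ₚ endOrder ·_) (≡.sym (∏ₚ-const λ e p → ⟦ c p <ᵇ c e ⟧))) ⟩
      (∏ₚ sameColourOrder · ∏ₚ sharedEnd) · (∏ₚ endOrder · ∏ₚ colourOrder)
        ≡⟨ ≡.trans (∏ₚ-· (λ e p s s' → sameColourOrder e p s s' · sharedEnd e p s s')
                         (λ e p s s' → endOrder e p s s' · colourOrder e p s s'))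
                   (≡.cong₂ _·_ (∏ₚ-· sameColourOrder sharedEnd) (∏ₚ-· endOrder colourOrder)) ⟨
      ∏ₚ (λ e p s s' → (sameColourOrder e p s s' · sharedEnd e p s s') · (endOrder e p s s' · colourOrder e p s s'))
        ≡⟨ ∏ₚ-cong (λ e p s s' → two-orders-sign (trichotomy (end e s) (end p s')) (trichotomy (c e) (c p))) ⟩
      ∏ₚ (λ e p s s' → concordant e p s s' · concordant p e s' s)
        ≡⟨ ∏ₚ-symmetrise concordant (λ e s s' → ≡.cong ⟦_⟧
             (≡.trans (≡.cong (end e s <ᵇ end e s' ∧_) (<ᵇ-irrefl (c e))) (Boolₚ.∧-zeroʳ _))) ⟩
      ∏[ e < m ] ∏[ p < m ] ∏[ s < 2 ] ∏[ s' < 2 ] concordant e p s s'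
        ≡⟨ ∏-ordered-halfEdge-pairs ⟩
      orderSign N k
        ∎)
      where
      open ≡.≡-Reasoning
      sameColourOrder sharedEnd endOrder colourOrder concordant : Fin m → Fin m → Fin 2 → Fin 2 → Sign
      sameColourOrder e p s s' = ⟦ c e ≡ᵇ c p ∧ end e s <ᵇ end p s' ⟧
      sharedEnd       e p s s' = ⟦ end e s ≡ᵇ end p s' ∧ c p <ᵇ c e ⟧
      endOrder        e p s s' = ⟦ end e s <ᵇ end p s' ⟧
      colourOrder     e p s s' = ⟦ c p <ᵇ c e ⟧
      concordant      e p s s' = ⟦ end e s <ᵇ end p s' ∧ c e <ᵇ c p ⟧

module _ {N : ℕ} (G : Graph N) {k : ℕ} (regular : Regular G k) {c c₀ : Fin (Graph.m G) → Fin k}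
         (proper : Proper G c) (proper₀ : Proper G c₀) where
  open Graph G
  module C  = Colouring G regular c  proper
  module C₀ = Colouring G regular c₀ proper₀

  parity-inversions : ∀ v → parity (inversions G c c₀ v) ≡ discord (C.edgeAt v) (C₀.edgeAt v)
  parity-inversions v = begin
    parity (inversions G c c₀ v)
      ≡⟨ parity-sumFin {m} _ ⟩
    ∏[ e < m ] parity (sumFin λ e' → sumFin λ f → count λ f' → I e ∧ I e' ∧ I f ∧ I f' ∧ R e e' f f')
      ≡⟨ ∏-cong {m} gates ⟩
    ∏[ e < m ] when (I e) (∏[ e' < m ] when (I e') (∏[ f < m ] when (I f) (∏[ f' < m ] when (I f') ⟦ R e e' f f' ⟧)))
      ≡⟨ reindex ⟩
    ∏[ α < k ] ∏[ β < k ] ∏[ γ < k ] ∏[ δ < k ] ⟦ R (h α) (h β) (g γ) (g δ) ⟧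
      ≡⟨ ∏-cong {k} (λ α → ∏-cong {k} λ β → collapse α β) ⟩
    discord h g
      ∎
    where
    open ≡.≡-Reasoning
    I : Fin m → Bool
    I = incident G v
    R : Fin m → Fin m → Fin m → Fin m → Bool
    R e e' f f' = e <ᵇ e' ∧ f' <ᵇ f ∧ c₀ f ≡ᵇ c e ∧ c₀ f' ≡ᵇ c e'
    h g : Fin k → Fin m
    h = C.edgeAt v
    g = C₀.edgeAt v
    gates : ∀ e → parity (sumFin λ e' → sumFin λ f → count λ f' → I e ∧ I e' ∧ I f ∧ I f' ∧ R e e' f f')
                ≡ when (I e) (∏[ e' < m ] when (I e') (∏[ f < m ] when (I f) (∏[ f' < m ] when (I f') ⟦ R e e' f f' ⟧)))
    gates e = begin
      parity (sumFin λ e' → sumFin λ f → count λ f' → I e ∧ I e' ∧ I f ∧ I f' ∧ R e e' f f')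
        ≡⟨ ≡.trans (parity-sumFin {m} _) (∏-cong {m} λ e' →
             ≡.trans (parity-sumFin {m} _) (∏-cong {m} λ f → parity-count {m} _)) ⟩
      ∏[ e' < m ] ∏[ f < m ] ∏[ f' < m ] ⟦ I e ∧ I e' ∧ I f ∧ I f' ∧ R e e' f f' ⟧
        ≡⟨ ∏-cong {m} (λ e' → ∏-cong {m} λ f → ∏-cong {m} λ f' → unfold (I e) (I e') (I f) (I f') _) ⟩
      ∏[ e' < m ] ∏[ f < m ] ∏[ f' < m ] when (I e) (when (I e') (when (I f) (when (I f') ⟦ R e e' f f' ⟧)))
        ≡⟨ ∏³-when {m} {m} {m} (I e) _ ⟩
      when (I e) (∏[ e' < m ] ∏[ f < m ] ∏[ f' < m ] when (I e') (when (I f) (when (I f') ⟦ R e e' f f' ⟧)))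
        ≡⟨ ≡.cong (when (I e)) (∏-cong {m} λ e' →
             ≡.trans (∏²-when {m} {m} (I e') _) (≡.cong (when (I e')) (∏-cong {m} λ f → ∏-when {m} (I f) _))) ⟩
      when (I e) (∏[ e' < m ] when (I e') (∏[ f < m ] when (I f) (∏[ f' < m ] when (I f') ⟦ R e e' f f' ⟧)))
        ∎
      where
      unfold : ∀ a b c d r → ⟦ a ∧ b ∧ c ∧ d ∧ r ⟧ ≡ when a (when b (when c (when d ⟦ r ⟧)))
      unfold a b c d r = ≡.trans (⟦∧⟧ a _) (≡.cong (when a) (≡.trans (⟦∧⟧ b _) (≡.cong (when b)
                           (≡.trans (⟦∧⟧ c _) (≡.cong (when c) (⟦∧⟧ d r))))))
    reindex : ∏[ e < m ] when (I e) (∏[ e' < m ] when (I e') (∏[ f < m ] when (I f) (∏[ f' < m ] when (I f') ⟦ R e e' f f' ⟧)))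
            ≡ ∏[ α < k ] ∏[ β < k ] ∏[ γ < k ] ∏[ δ < k ] ⟦ R (h α) (h β) (g γ) (g δ) ⟧
    reindex = ≡.trans (C.∏-incident v _) (∏-cong {k} λ α →
              ≡.trans (C.∏-incident v _) (∏-cong {k} λ β →
              ≡.trans (C₀.∏-incident v _) (∏-cong {k} λ γ → C₀.∏-incident v _)))
    collapse : ∀ α β → ∏[ γ < k ] ∏[ δ < k ] ⟦ R (h α) (h β) (g γ) (g δ) ⟧ ≡ ⟦ h α <ᵇ h β ∧ g β <ᵇ g α ⟧
    collapse α β = begin
      ∏[ γ < k ] ∏[ δ < k ] ⟦ R (h α) (h β) (g γ) (g δ) ⟧
        ≡⟨ ∏-cong {k} (λ γ → ∏-cong {k} λ δ → recolour γ δ) ⟩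
      ∏[ γ < k ] ∏[ δ < k ] when (γ ≡ᵇ α) (when (δ ≡ᵇ β) ⟦ h α <ᵇ h β ∧ g δ <ᵇ g γ ⟧)
        ≡⟨ ∏-cong {k} (λ γ → ≡.trans (∏-when {k} (γ ≡ᵇ α) _) (≡.cong (when (γ ≡ᵇ α)) (only β))) ⟩
      ∏[ γ < k ] when (γ ≡ᵇ α) ⟦ h α <ᵇ h β ∧ g β <ᵇ g γ ⟧
        ≡⟨ only α ⟩
      ⟦ h α <ᵇ h β ∧ g β <ᵇ g α ⟧
        ∎
      where
      recolour : ∀ γ δ → ⟦ R (h α) (h β) (g γ) (g δ) ⟧ ≡
                         when (γ ≡ᵇ α) (when (δ ≡ᵇ β) ⟦ h α <ᵇ h β ∧ g δ <ᵇ g γ ⟧)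
      recolour γ δ rewrite C₀.edgeAt-colour v γ | C₀.edgeAt-colour v δ | C.edgeAt-colour v α | C.edgeAt-colour v β =
        ⟦∧⟧-gate₃₄ (h α <ᵇ h β) (g δ <ᵇ g γ) (γ ≡ᵇ α) (δ ≡ᵇ β)
      only : ∀ κ {F : Fin k → Sign} → ∏[ ζ < k ] when (ζ ≡ᵇ κ) (F ζ) ≡ F κ
      only κ = ∏-when-unique (_≡ᵇ κ) _ κ (≡ᵇ-refl κ) (λ _ → ≡ᵇ-sound)

  sgnAt≡vertexSigns : ∀ v → sgnAt G c c₀ v ≡ vertexSign G c v · vertexSign G c₀ v
  sgnAt≡vertexSigns v = begin
    sgnAt G c c₀ v
      ≡⟨ parity-inversions v ⟩
    discord (C.edgeAt v) (C₀.edgeAt v)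
      ≡⟨ discord-through-id (C.edgeAt-injective v) (C₀.edgeAt-injective v) ⟩
    discord (C.edgeAt v) id · discord (C₀.edgeAt v) id
      ≡⟨ ≡.cong₂ _·_ (C.vertexSign≡discord v) (C₀.vertexSign≡discord v) ⟨
    vertexSign G c v · vertexSign G c₀ v
      ∎
    where open ≡.≡-Reasoning

  sgnRel≡colouringSigns : sgnRel G c c₀ ≡ colouringSign G c · colouringSign G c₀
  sgnRel≡colouringSigns =
    ≡.trans (prodSign≡∏ (sgnAt G c c₀)) (≡.trans (∏-cong {N} sgnAt≡vertexSigns) (∏-distrib-· {N} _ _))

theorem2 : (n k : ℕ) (G : Graph (2 * n)) (c₀ c : Fin (Graph.m G) → Fin k) →
           Regular G k → Proper G c₀ → Proper G c →
           sgnCol G c₀ c ≡ prodSign (λ α → sgnFactor G (colorClass G c α))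
theorem2 n k G c₀ c regular proper₀ proper = begin
  sgnRel G c c₀ · parity (intCol G c₀)
    ≡⟨ ≡.cong₂ _·_ (sgnRel≡colouringSigns G regular proper proper₀) (Colouring.parity-intCol G regular c₀ proper₀) ⟩
  (colouringSign G c · colouringSign G c₀) · (colouringSign G c₀ · crossingConstant G k)
    ≡⟨ ·-cancel-middle (colouringSign G c) (colouringSign G c₀) (crossingConstant G k) ⟩
  colouringSign G c · crossingConstant G k
    ≡⟨ Colouring.parity-intCol G regular c proper ⟨
  parity (intCol G c)
    ≡⟨ parity-sumFin {k} _ ⟩
  ∏[ α < k ] sgnFactor G (colorClass G c α)
    ≡⟨ prodSign≡∏ (λ α → sgnFactor G (colorClass G c α)) ⟨
  prodSign (λ α → sgnFactor G (colorClass G c α))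
    ∎
  where open ≡.≡-Reasoning
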